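{- Let $w\in\mathfrak S_n$ and $\rho\in R(w)$. Then $\mathrm{inv}(\rho)=\ell(\mathrm{perm}(\rho))-\sum_{i=1}^{\ell(w)}(\pi_i-\rho_i)$ is a well-defined non-negative integer, where $\pi$ is the super-Yamanouchi reduced word for $w$. Moreover, there exists a sequence $f=f_{\mathrm{inv}(\rho)}\cdots f_1$ of Coxeter moves (each $f_j$ equal to some $\mathfrak c_i$ or $\mathfrak b_i$) such that $f(\rho)$ is super-Yamanouchi, and for any sequence $g=g_m\cdots g_1$ of Coxeter moves such that $g(\rho)$ is super-Yamanouchi, we have $m\ge \mathrm{inv}(\rho)$.
   Context: $s_i$ is the simple transposition of $\mathfrak S_n$; acting on a permutation in one-line notation it exchanges the entries in positions $i$ and $i+1$. $\ell(w)$ is the number of pairs $i<j$ with $w_i>w_j$. A reduced word for $w$ is a sequence $\rho=(\rho_\ell,\ldots,\rho_1)$, $\ell=\ell(w)$, indexed from right to left, with $w=s_{\rho_\ell}\cdots s_{\rho_1}\cdot\mathrm{id}$; $R(w)$ is the set of reduced words. The runs of $\rho$ are the maximal consecutive segments of $\rho$ that are strictly increasing read left to right, listed $(\rho^{(k)}\mid\cdots\mid\rho^{(1)})$ from left to right; $\rho$ is super-Yamanouchi if every run consists of consecutive integers and $\min(\rho^{(k)})>\cdots>\min(\rho^{(1)})$. Each $w$ has a unique super-Yamanouchi reduced word $\pi=(\pi_\ell,\ldots,\pi_1)$. Coxeter moves on $R(w)$: for $1\le i<\ell$, $\mathfrak c_i$ exchanges $\rho_i$ and $\rho_{i+1}$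 if $|\rho_i-\rho_{i+1}|>1$ and is the identity otherwise (commutation); for $1<i<\ell$, $\mathfrak b_i$ acts, when $\rho_{i-1}=\rho_{i+1}=a$ and $\rho_i=a\pm1$, by replacing the three letters in positions $i+1,i,i-1$, namely $a,a\pm1,a$, with $a\pm1,a,a\pm1$, and is the identity otherwise (Yang--Baxter move). The permutation $\mathrm{perm}(\rho)=v_1v_2\cdots v_\ell\in\mathfrak S_\ell$ (one-line notation) is computed as follows: initially all positions of $\rho$ are unpaired. For $i=\ell,\ell-1,\ldots,1$ in turn: set $k:=\pi_i$ and scan $j=\ell,\ell-1,\ldots,1$ in turn; if position $j$ is unpaired and $\rho_j=k$, pair position $j$ with $i$, set $v_i:=j$ and stop the scan; otherwise, if position $j$ is unpaired and $\rho_j=k-1$, replace $k$ by $k-1$ and continue scanning. $\ell(\mathrm{perm}(\rho))$ is the number of inversions of this permutation. -}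

module Defs where

open import Data.Bool using (Bool; true; false; if_then_else_; _∧_; _∨_; not)
open import Data.Nat using (ℕ; zero; suc; _∸_; _≤_; _<_; _>_; _≡ᵇ_; _<ᵇ_; _⊓_)
open import Data.List using (List; []; _∷_; foldl; foldr; map; reverse; upTo; downFrom; length; zipWith)
open import Data.Bool.ListAction using (any)
open import Data.Maybe using (Maybe; just; nothing)
import Data.Maybe as Maybe
open import Data.Integer as ℤ using (ℤ; +_)
open import Data.Product using (_×_)
open import Data.List.Relation.Unary.All using (All)
open import Data.List.Relation.Unary.Linked using (Linked)
open import Relation.Binary.PropositionalEquality using (_≡_)

-- Conventions.
-- A permutation of 𝔖_n is its one-line notation, a list of naturals that is a
-- rearrangement of idList n = [1,2,…,n].
-- A word ρ = (ρ_ℓ,…,ρ_1) is stored as the list [ρ_1, ρ_2, …, ρ_ℓ]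
-- (list index i-1 holds ρ_i); the word as written left to right is its reverse.

idList : ℕ → List ℕ
idList n = map suc (upTo n)

-- ρ_i for 1 ≤ i ≤ length (default 0 outside range)
at : List ℕ → ℕ → ℕ
at []       _             = 0
at (x ∷ xs) zero          = 0
at (x ∷ xs) (suc zero)    = x
at (x ∷ xs) (suc (suc k)) = at xs (suc k)

countLess : ℕ → List ℕ → ℕ
countLess x []       = 0
countLess x (y ∷ ys) = if y <ᵇ x then suc (countLess x ys) else countLess x ys

inversions : List ℕ → ℕ
inversions []       = 0
inversions (x ∷ xs) = countLess x xs Data.Nat.+ inversions xs

-- s_i acting on one-line notation: exchange entries in positions i, i+1 (1-based)
swapAt : ℕ → List ℕ → List ℕ
swapAt (suc zero)    (x ∷ y ∷ r) = y ∷ x ∷ r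
swapAt (suc (suc k)) (x ∷ r)     = x ∷ swapAt (suc k) r
swapAt _             r           = r

-- s_{ρ_ℓ} ⋯ s_{ρ_1} · id  (ρ_1 acts first)
wordPerm : ℕ → List ℕ → List ℕ
wordPerm n ρ = foldl (λ v a → swapAt a v) (idList n) ρ

Reduced : ℕ → List ℕ → List ℕ → Set
Reduced n w ρ =
  All (λ a → 1 ≤ a × a < n) ρ × wordPerm n ρ ≡ w × length ρ ≡ inversions w

insertRun : ℕ → List (List ℕ) → List (List ℕ)
insertRun x []             = (x ∷ []) ∷ []
insertRun x ([] ∷ rs)      = (x ∷ []) ∷ [] ∷ rs
insertRun x ((y ∷ r) ∷ rs) =
  if x <ᵇ y then (x ∷ y ∷ r) ∷ rs else (x ∷ []) ∷ (y ∷ r) ∷ rs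

runs : List ℕ → List (List ℕ)
runs = foldr insertRun []

minL : List ℕ → ℕ
minL []       = 0
minL (x ∷ xs) = foldr _⊓_ x xs

Consecutive : List ℕ → Set
Consecutive = Linked (λ a b → b ≡ suc a)

-- super-Yamanouchi, for a word written left to right (ρ^(k) | ⋯ | ρ^(1))
SuperYamanouchiWritten : List ℕ → Set
SuperYamanouchiWritten σ = All Consecutive (runs σ) × Linked _>_ (map minL (runs σ))

SuperYamanouchi : List ℕ → Set
SuperYamanouchi ρ = SuperYamanouchiWritten (reverse ρ)

-- Coxeter moves (on storage order; 0-based list index k = i-1 holds ρ_i)
cAt : ℕ → List ℕ → List ℕ
cAt zero (x ∷ y ∷ r) =
  if (suc x <ᵇ y) ∨ (suc y <ᵇ x) then y ∷ x ∷ r else x ∷ y ∷ r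
cAt (suc k) (x ∷ r) = x ∷ cAt k r
cAt _ r = r

𝔠 : ℕ → List ℕ → List ℕ
𝔠 i = cAt (i ∸ 1)

bAt : ℕ → List ℕ → List ℕ
bAt zero (x ∷ y ∷ z ∷ r) =
  if (x ≡ᵇ z) ∧ ((y ≡ᵇ suc x) ∨ (x ≡ᵇ suc y)) then y ∷ x ∷ y ∷ r else x ∷ y ∷ z ∷ r
bAt (suc k) (x ∷ r) = x ∷ bAt k r
bAt _ r = r

-- 𝔟_i : if ρ_{i-1} = ρ_{i+1} = a and ρ_i = a ± 1, replace (a, a±1, a) by (a±1, a, a±1)
𝔟 : ℕ → List ℕ → List ℕ
𝔟 i = bAt (i ∸ 2)

data Move (ℓ : ℕ) : Set where
  c : (i : ℕ) → 1 ≤ i → i < ℓ → Move ℓ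
  b : (i : ℕ) → 1 < i → i < ℓ → Move ℓ

applyMove : {ℓ : ℕ} → Move ℓ → List ℕ → List ℕ
applyMove (c i _ _) = 𝔠 i
applyMove (b i _ _) = 𝔟 i

-- a list [g_1, …, g_m] represents g = g_m ⋯ g_1 (g_1 applied first)
applyMoves : {ℓ : ℕ} → List (Move ℓ) → List ℕ → List ℕ
applyMoves gs ρ = foldl (λ σ g → applyMove g σ) ρ gs

memb : ℕ → List ℕ → Bool
memb j P = any (λ p → p ≡ᵇ j) P

-- scan positions js (in order ℓ, ℓ-1, …, 1) with current target k, paired set P
scan : List ℕ → ℕ → List ℕ → List ℕ → Maybe ℕ
scan ρ k []       P = nothing
scan ρ k (j ∷ js) P =
  if memb j P then scan ρ k js P
  else (if at ρ j ≡ᵇ k then just j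
  else (if at ρ j ≡ᵇ (k ∸ 1) then scan ρ (k ∸ 1) js P
  else scan ρ k js P))

-- process i over the list is (ℓ, ℓ-1, …, 1), returning [v_ℓ, …, v_1]
pairLoop : List ℕ → List ℕ → List ℕ → List ℕ → List ℕ → Maybe (List ℕ)
pairLoop ρ π js []       P = just []
pairLoop ρ π js (i ∷ is) P with scan ρ (at π i) js P
... | nothing = nothing
... | just j  = Maybe.map (j ∷_) (pairLoop ρ π js is (j ∷ P))

-- perm(ρ) = v_1 ⋯ v_ℓ in one-line notation (nothing if some scan fails)
permOf : List ℕ → List ℕ → Maybe (List ℕ)
permOf ρ π =
  Maybe.map reverse (pairLoop ρ π (reverse (idList (length ρ))) (reverse (idList (length ρ))) [])

sumDiff : List ℕ → List ℕ → ℤ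
sumDiff π ρ = foldr ℤ._+_ (+ 0) (zipWith (λ p r → (+ p) ℤ.- (+ r)) π ρ)

{-# OPTIONS --safe #-}
-- Read words in written order. Let π begin with k, so that w = s_k u with u shorter. Since w
-- increases after position k, the scan for k follows the entry x = w_k backwards in time until
-- it meets y = w_{k+1}; deleting the letter found there leaves a reduced word of u, and the
-- construction of perm(ρ) goes on with that word. Hence inv(ρ) is the sum, over all scans, of
-- the number of letters passed that do not lower the target.
--
-- A Coxeter move either survives the deletion or changes the number of such letters by one, so
-- inv changes by at most one per move; as inv(π) = 0 this is the lower bound. Conversely, let D
-- be a letter and look at the leftmost D in a word whose letters are at least D (up to a finished
-- tail), followed by a maximal block D, D+1, …, p-1. If the block is not the end of the word,
-- the next letter can be moved left into the block by a commutation or a braid move. No scan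
-- target above D is ever found inside the block, so this move lowers inv by exactly one; when
-- no such move is left for any D, the word is super-Yamanouchi, hence equal to π.
module Submission where

open import Defs
open import Data.Nat using (ℕ; _≤_)
open import Data.List using (List; length)
open import Data.Maybe using (just)
open import Data.Integer using (+_; _-_)
open import Data.Product using (Σ; _×_)
open import Data.List.Relation.Binary.Permutation.Propositional using (_↭_)
open import Relation.Binary.PropositionalEquality using (_≡_)

open import Data.Bool using (true; false; if_then_else_; T)
open import Data.Bool.Properties using (∨-zeroʳ)
open import Data.Empty using (⊥; ⊥-elim)
import Data.Integer as ℤ
import Data.Integer.Tactic.RingSolver as ℤ-solver
open import Data.List using ([]; _∷_; _++_; drop; foldl; foldr; map; reverse; upTo; applyUpTo)
open import Data.List.Properties using (++-assoc; ++-identityʳ; reverse-++; unfold-reverse; length-reverse; map-∘; map-upTo; reverse-map; reverse-upTo; reverse-involutive)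
open import Data.List.Relation.Binary.Permutation.Propositional using (↭-refl; ↭-reflexive; ↭-prep; ↭-sym; ↭-trans)
open import Data.List.Relation.Binary.Permutation.Propositional.Properties using (map⁺; shift; ↭-reverse)
open import Data.List.Relation.Unary.All as All using (All; []; _∷_)
open import Data.List.Relation.Unary.All.Properties using (++⁺; ++⁻ˡ; ++⁻ʳ)
open import Data.List.Relation.Unary.AllPairs using (AllPairs; []; _∷_)
import Data.List.Relation.Unary.AllPairs.Properties as AllPairsₚ
open import Data.List.Relation.Unary.Linked using (Linked; []; [-]; _∷_)
import Data.Maybe as Maybe
open import Data.Nat using (zero; suc; _+_; _∸_; _<_; _>_; _⊓_; _≡ᵇ_; _<ᵇ_; z≤n; s≤s; _≟_; _<?_)
open import Data.Nat.ListAction using (sum)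
open import Data.Nat.ListAction.Properties using (sum-↭)
open import Data.Nat.Properties
open import Algebra.Properties.CommutativeSemigroup +-commutativeSemigroup using (x∙yz≈y∙xz)
import Data.Nat.Tactic.RingSolver as ℕ-solver
open import Data.Product using (_,_; ∃; ∃₂; proj₁; proj₂)
open import Data.Sum as Sum using (_⊎_; inj₁; inj₂)
open import Function using (_∘_; flip)
open import Relation.Binary.Definitions using (tri<; tri≈; tri>)
open import Relation.Binary.PropositionalEquality using (refl; sym; trans; cong; cong₂; subst; subst₂; _≢_)
open import Relation.Nullary using (¬_; yes; no)

private variable
  a d h k m n p q v x y z D N : ℕ
  e t u u′ w w′ L L′ L₁ P : List ℕ

Increasing : List ℕ → Set
Increasing = AllPairs _<_

-- Ascending transpositions and reduced words

-- Only ascents are exchanged, so each step adds one inversion and reducedness is built into `Word`.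
data Step : ℕ → List ℕ → List ℕ → Set where
  here  : x < y → Step 1 (x ∷ y ∷ t) (y ∷ x ∷ t)
  there : Step k u w → Step (suc k) (x ∷ u) (x ∷ w)

-- The letters are in written order: the head is the last transposition applied.
data Word (e : List ℕ) : List ℕ → List ℕ → Set where
  []  : Word e [] e
  _∷_ : Step k u w → Word e L u → Word e (k ∷ L) w

step-positive : Step k u w → 1 ≤ k
step-positive (here _)  = s≤s z≤n
step-positive (there _) = s≤s z≤n

step-length : Step k u w → length u ≡ length w
step-length (here _)  = refl
step-length (there s) = cong suc (step-length s)

step-<length : Step k u w → k < length w
step-<length (here _)  = s≤s (s≤s z≤n)
step-<length (there s) = s≤s (step-<length s)

step-injective : Step k u w → Step k u′ w → u ≡ u′
step-injective (here _)          (here _)          = refl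
step-injective (there {x = x} s) (there s′)        = cong (x ∷_) (step-injective s s′)
step-injective (here _)          (there ())
step-injective (there ())        (here _)

step-no-square : Step k u w → Step k u′ u → ⊥
step-no-square (here x<y)  (here y<x)  = <-asym x<y y<x
step-no-square (there s)   (there s′)  = step-no-square s s′
step-no-square (here _)    (there ())
step-no-square (there ())  (here _)

descent-≤ : Step h u w → Increasing (drop k w) → h ≤ k
descent-≤ {k = zero}  (here x<y) ((y<x ∷ _) ∷ _) = ⊥-elim (<-asym x<y y<x)
descent-≤ {k = zero}  (there s)  (_ ∷ inc) with descent-≤ {k = 0} s inc
descent-≤ {k = zero}  (there ()) (_ ∷ inc) | z≤n
descent-≤ {k = suc k} (here _)   inc = s≤s z≤n
descent-≤ {k = suc k} (there s)  inc = s≤s (descent-≤ s inc)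

no-descent : Increasing w → ¬ Step h u w
no-descent inc s with descent-≤ {k = 0} s inc
no-descent inc () | z≤n

word-letters : Word e L w → All (λ k → 1 ≤ k × k < length w) L
word-letters []      = []
word-letters (s ∷ W) = (step-positive s , step-<length s) ∷
  subst (λ l → All (λ k → 1 ≤ k × k < l) _) (step-length s) (word-letters W)

word-of-increasing : Increasing e → Word e L e → L ≡ []
word-of-increasing inc []      = refl
word-of-increasing inc (s ∷ W) = ⊥-elim (no-descent inc s)

word-no-square : ¬ Word e (k ∷ k ∷ L) w
word-no-square (s ∷ s′ ∷ _) = step-no-square s s′

-- Inversion numbers under adjacent transpositions

<⇒<ᵇ≡true : x < y → (x <ᵇ y) ≡ true
<⇒<ᵇ≡true {x} {y} x<y with x <ᵇ y | <⇒<ᵇ x<y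
... | true | _ = refl

≮⇒<ᵇ≡false : ¬ x < y → (x <ᵇ y) ≡ false
≮⇒<ᵇ≡false {x} {y} x≮y with x <ᵇ y | <ᵇ⇒< x y
... | true  | f = ⊥-elim (x≮y (f _))
... | false | _ = refl

countLess-swapAt : ∀ x k u → countLess x (swapAt k u) ≡ countLess x u
countLess-swapAt x zero          u           = refl
countLess-swapAt x (suc zero)    []          = refl
countLess-swapAt x (suc zero)    (y ∷ [])    = refl
countLess-swapAt x (suc zero)    (y ∷ z ∷ u) with y <ᵇ x | z <ᵇ x
... | true  | true  = refl
... | true  | false = refl
... | false | true  = refl
... | false | false = refl
countLess-swapAt x (suc (suc k)) []          = refl
countLess-swapAt x (suc (suc k)) (y ∷ u) rewrite countLess-swapAt x (suc k) u = refl

swapAt-inversions : ∀ k u →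
  (Step k u (swapAt k u) × inversions (swapAt k u) ≡ suc (inversions u)) ⊎
  inversions (swapAt k u) ≤ inversions u
swapAt-inversions zero          u           = inj₂ ≤-refl
swapAt-inversions (suc zero)    []          = inj₂ ≤-refl
swapAt-inversions (suc zero)    (y ∷ [])    = inj₂ ≤-refl
swapAt-inversions (suc zero)    (y ∷ z ∷ u) with y <? z
... | yes y<z rewrite <⇒<ᵇ≡true y<z | ≮⇒<ᵇ≡false (<-asym y<z) =
  inj₁ (here y<z , cong suc (x∙yz≈y∙xz (countLess z u) (countLess y u) (inversions u)))
... | no y≮z rewrite ≮⇒<ᵇ≡false y≮z with z <ᵇ y
...   | true  = inj₂ (m≤n⇒m≤1+n (≤-reflexive (x∙yz≈y∙xz (countLess z u) (countLess y u) (inversions u))))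
...   | false = inj₂ (≤-reflexive (x∙yz≈y∙xz (countLess z u) (countLess y u) (inversions u)))
swapAt-inversions (suc (suc k)) []          = inj₂ ≤-refl
swapAt-inversions (suc (suc k)) (y ∷ u) rewrite countLess-swapAt y (suc k) u with swapAt-inversions (suc k) u
... | inj₁ (s , eq) = inj₁ (there s , trans (cong (_+_ (countLess y u)) eq) (+-suc _ _))
... | inj₂ le       = inj₂ (+-monoʳ-≤ (countLess y u) le)

swaps : List ℕ → List ℕ → List ℕ
swaps = foldl (λ v a → swapAt a v)

inversions-swaps : ∀ ρ u → inversions (swaps u ρ) ≤ length ρ + inversions u
inversions-swaps []      u = ≤-refl
inversions-swaps (k ∷ ρ) u with swapAt-inversions k u
... | inj₁ (_ , eq) = ≤-trans (inversions-swaps ρ (swapAt k u))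
  (≤-reflexive (trans (cong (_+_ (length ρ)) eq) (+-suc _ _)))
... | inj₂ le       = m≤n⇒m≤1+n (≤-trans (inversions-swaps ρ (swapAt k u)) (+-monoʳ-≤ (length ρ) le))

-- Equality with the bound of `inversions-swaps` means that no letter is wasted, so each one
-- exchanges an ascent. The fold reverses storage order into written order.
word-swaps : ∀ ρ → Word e L u → inversions (swaps u ρ) ≡ length ρ + inversions u →
  Word e (foldl (flip _∷_) L ρ) (swaps u ρ)
word-swaps []              W eq = W
word-swaps {u = u} (k ∷ ρ) W eq with swapAt-inversions k u
... | inj₁ (s , eq′) = word-swaps ρ (s ∷ W) (trans eq (sym (trans (cong (_+_ (length ρ)) eq′) (+-suc _ _))))
... | inj₂ le        = ⊥-elim (<-irrefl eq
  (s≤s (≤-trans (inversions-swaps ρ (swapAt k u)) (+-monoʳ-≤ (length ρ) le))))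

countLess-min : All (x <_) t → countLess x t ≡ 0
countLess-min []         = refl
countLess-min (x<y ∷ ps) rewrite ≮⇒<ᵇ≡false (<-asym x<y) = countLess-min ps

inversions-increasing : Increasing u → inversions u ≡ 0
inversions-increasing []          = refl
inversions-increasing (ps ∷ inc) rewrite countLess-min ps = inversions-increasing inc

-- Coxeter moves on written words

Far : ℕ → ℕ → Set
Far a d = suc a < d ⊎ suc d < a

infix 4 _⟶_
-- Only moves that change the word; a move acting as the identity is a separate case of
-- `applyMove-sound`.
data _⟶_ : List ℕ → List ℕ → Set where
  comm   : Far a d → (a ∷ d ∷ L) ⟶ (d ∷ a ∷ L)
  braid↑ : (a ∷ suc a ∷ a ∷ L) ⟶ (suc a ∷ a ∷ suc a ∷ L)
  braid↓ : (suc a ∷ a ∷ suc a ∷ L) ⟶ (a ∷ suc a ∷ a ∷ L)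
  there  : L ⟶ L′ → (a ∷ L) ⟶ (a ∷ L′)

far-sym : Far a d → Far d a
far-sym (inj₁ lt) = inj₂ lt
far-sym (inj₂ lt) = inj₁ lt

far⇒≢ : Far a d → a ≢ d
far⇒≢ (inj₁ lt) refl = <-irrefl refl (<-trans (n<1+n _) lt)
far⇒≢ (inj₂ lt) refl = <-irrefl refl (<-trans (n<1+n _) lt)

far⇒suc≢ : Far a d → suc a ≢ d
far⇒suc≢ (inj₁ lt) refl = <-irrefl refl lt
far⇒suc≢ (inj₂ lt) refl = <-irrefl refl (<-trans (n<1+n _) (<-trans (n<1+n _) lt))

far-intro : a ≢ d → suc a ≢ d → suc d ≢ a → Far a d
far-intro {a} {d} a≢d sa≢d sd≢a with <-cmp (suc a) d
... | tri< lt _ _ = inj₁ lt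

... | tri≈ _ eq _ = ⊥-elim (sa≢d eq)
... | tri> _ _ gt = inj₂ (≤∧≢⇒< (≤∧≢⇒< (≤-pred gt) (a≢d ∘ sym)) sd≢a)

far-pred : Far (suc a) (suc d) → Far a d
far-pred = Sum.map ≤-pred ≤-pred

step-comm : Far a d → Step a u w → Step d t u → ∃ λ u′ → Step d u′ w × Step a t u′
step-comm far (here x<y)        (here _)          = ⊥-elim (far⇒≢ far refl)
step-comm far (here x<y)        (there (here _))  = ⊥-elim (far⇒suc≢ far refl)
step-comm far (here x<y)        (there (there s)) = _ , there (there s) , here x<y
step-comm far (there (here _))  (here _)          = ⊥-elim (far⇒suc≢ (far-sym far) refl)
step-comm far (there (there s)) (here x<y)        = _ , here x<y , there (there s)
step-comm far (there s)         (there s′) with step-comm (far-pred far) s s′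
... | _ , r , r′ = _ , there r , there r′

-- Both triples reverse the same three adjacent entries and make the same three comparisons, in
-- opposite orders.
step-braid↑ : ∀ {u₁ u₂ u₃} → Step a u₃ w → Step (suc a) u₂ u₃ → Step a u₁ u₂ →
  ∃₂ λ v₃ v₂ → Step (suc a) v₃ w × Step a v₂ v₃ × Step (suc a) u₁ v₂
step-braid↑ (here lt)  (there (here lt′))  (here lt″)  = _ , _ , there (here lt″) , here lt′ , there (here lt)
step-braid↑ (there s)  (there s′)          (there s″) with step-braid↑ s s′ s″
... | _ , _ , r , r′ , r″ = _ , _ , there r , there r′ , there r″
step-braid↑ (here _)   (there (there ()))  _
step-braid↑ (here _)   (there (here _))    (there ())
step-braid↑ (there ()) (there (here _))    (here _)

step-braid↓ : ∀ {u₁ u₂ u₃} → Step (suc a) u₃ w → Step a u₂ u₃ → Step (suc a) u₁ u₂ →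
  ∃₂ λ v₃ v₂ → Step a v₃ w × Step (suc a) v₂ v₃ × Step a u₁ v₂
step-braid↓ (there (here lt)) (here lt′)  (there (here lt″)) = _ , _ , here lt″ , there (here lt′) , here lt
step-braid↓ (there s)         (there s′)  (there s″) with step-braid↓ s s′ s″
... | _ , _ , r , r′ , r″ = _ , _ , there r , there r′ , there r″
step-braid↓ (there (here _))  (here _)    (there (there ()))
step-braid↓ (there (there ())) (here _)   _

word-move : L ⟶ L′ → Word e L w → Word e L′ w
word-move (comm far) (s ∷ s′ ∷ W) with step-comm far s s′
... | _ , r , r′ = r ∷ r′ ∷ W
word-move braid↑ (s ∷ s′ ∷ s″ ∷ W) with step-braid↑ s s′ s″
... | _ , _ , r , r′ , r″ = r ∷ r′ ∷ r″ ∷ W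
word-move braid↓ (s ∷ s′ ∷ s″ ∷ W) with step-braid↓ s s′ s″
... | _ , _ , r , r′ , r″ = r ∷ r′ ∷ r″ ∷ W
word-move (there mv) (s ∷ W) = s ∷ word-move mv W

-- Scanning for a letter and deleting it

-- One scan for the target k: L₁ is L without the paired letter, and m counts
-- the letters passed that did not lower the target.
data Extract : ℕ → List ℕ → ℕ → List ℕ → Set where
  here : Extract k (k ∷ L) 0 L
  down : Extract k L m L₁ → Extract (suc k) (k ∷ L) m (k ∷ L₁)
  pass : a ≢ k → suc a ≢ k → Extract k L m L₁ → Extract k (a ∷ L) (suc m) (a ∷ L₁)

-- Dist L P N says that inv(ρ) = N, for ρ written as L and π written as P.
data Dist : List ℕ → List ℕ → ℕ → Set where
  []  : Dist [] [] 0
  _∷_ : Extract k L m L₁ → Dist L₁ P N → Dist L (k ∷ P) (m + N)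

extract-unique : ∀ {m′ L₁′} → Extract k L m L₁ → Extract k L m′ L₁′ → m ≡ m′ × L₁ ≡ L₁′
extract-unique here         here           = refl , refl
extract-unique here         (pass ne _ _)  = ⊥-elim (ne refl)
extract-unique (down E)     (down E′) with extract-unique E E′
... | refl , refl = refl , refl
extract-unique (down E)     (pass _ ne _)  = ⊥-elim (ne refl)
extract-unique (pass ne _ _) here          = ⊥-elim (ne refl)
extract-unique (pass _ ne _) (down _)      = ⊥-elim (ne refl)
extract-unique (pass _ _ E) (pass _ _ E′) with extract-unique E E′
... | refl , refl = refl , refl

dist-unique : ∀ {N′} → Dist L P N → Dist L P N′ → N ≡ N′
dist-unique []      []        = refl
dist-unique (E ∷ Δ) (E′ ∷ Δ′) with extract-unique E E′
... | refl , refl = cong (_+_ _) (dist-unique Δ Δ′)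

dist-refl : ∀ P → Dist P P 0
dist-refl []      = []
dist-refl (k ∷ P) = here ∷ dist-refl P

-- Once one of two far letters has lowered the target, the other neither matches nor lowers it. So
-- the exchange matters only if one of them is paired, and then the other is passed in exactly one
-- of the two orders.
extract-comm : Far a d → Extract k (a ∷ d ∷ L) m L₁ →
  (∃ λ L₂ → L₁ ≡ a ∷ d ∷ L₂ × Extract k (d ∷ a ∷ L) m (d ∷ a ∷ L₂)) ⊎
  (k ≡ a × m ≡ 0 × Extract k (d ∷ a ∷ L) 1 L₁) ⊎
  (m ≡ 1 × Extract k (d ∷ a ∷ L) 0 L₁)
extract-comm far here = inj₂ (inj₁ (refl , refl , pass (far⇒≢ (far-sym far)) (far⇒suc≢ (far-sym far)) here))
extract-comm far (down here)     = ⊥-elim (far⇒≢ far refl)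
extract-comm far (down (down E)) = ⊥-elim (far⇒suc≢ (far-sym far) refl)
extract-comm far (down (pass d≢a _ E)) =
  inj₁ (_ , refl , pass (far⇒suc≢ far ∘ sym) (d≢a ∘ suc-injective) (down E))
extract-comm far (pass _ _ here) = inj₂ (inj₂ (refl , here))
extract-comm far (pass a≢k _ (down E)) =
  inj₁ (_ , refl , down (pass (far⇒≢ far) (far⇒suc≢ far) E))
extract-comm far (pass n₁ n₂ (pass n₃ n₄ E)) = inj₁ (_ , refl , pass n₃ n₄ (pass n₁ n₂ E))

-- Target `suc a` is lowered by the first `a` and paired with the last; after the move it is paired
-- at once, and both deletions leave `a`, `suc a`. Target `suc (suc a)` is lowered twice in either
-- word. Target `a` is excluded because its deletion from the new word leaves a square.
extract-braid↑ : a ≢ k → Extract k (a ∷ suc a ∷ a ∷ L) m L₁ →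
  (∃ λ L₂ → L₁ ≡ a ∷ suc a ∷ a ∷ L₂ × Extract k (suc a ∷ a ∷ suc a ∷ L) m (suc a ∷ a ∷ suc a ∷ L₂)) ⊎
  (m ≡ 1 × Extract k (suc a ∷ a ∷ suc a ∷ L) 0 L₁)
extract-braid↑ a≢k here = ⊥-elim (a≢k refl)
extract-braid↑ a≢k (down (pass _ _ here))          = inj₂ (refl , here)
extract-braid↑ a≢k (down (pass _ _ (pass ne _ _))) = ⊥-elim (ne refl)
extract-braid↑ a≢k (pass _ ne here)                = ⊥-elim (ne refl)
extract-braid↑ a≢k (pass _ _ (down (down E)))      = inj₁ (_ , refl , down (down (pass (λ ()) (λ ()) E)))
extract-braid↑ a≢k (pass _ _ (down (pass _ ne _))) = ⊥-elim (ne refl)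
extract-braid↑ a≢k (pass _ _ (pass _ _ here))      = ⊥-elim (a≢k refl)
extract-braid↑ a≢k (pass _ ne (pass _ _ (down _))) = ⊥-elim (ne refl)
extract-braid↑ a≢k (pass n₁ n₂ (pass n₃ n₄ (pass _ _ E))) =
  inj₁ (_ , refl , pass n₃ n₄ (pass n₁ n₂ (pass n₃ n₄ E)))

extract-braid↓ : a ≢ k → Extract k (suc a ∷ a ∷ suc a ∷ L) m L₁ →
  (∃ λ L₂ → L₁ ≡ suc a ∷ a ∷ suc a ∷ L₂ × Extract k (a ∷ suc a ∷ a ∷ L) m (a ∷ suc a ∷ a ∷ L₂)) ⊎
  (m ≡ 0 × Extract k (a ∷ suc a ∷ a ∷ L) 1 L₁)
extract-braid↓ a≢k here = inj₂ (refl , down (pass (λ ()) (λ ()) here))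
extract-braid↓ a≢k (down (down (pass n₁ n₂ E)))   = inj₁ (_ , refl , pass (λ ()) (λ ()) (down (down E)))
extract-braid↓ a≢k (down (pass _ ne _))           = ⊥-elim (ne refl)
extract-braid↓ a≢k (pass _ _ here)                = ⊥-elim (a≢k refl)
extract-braid↓ a≢k (pass ne _ (down _))           = ⊥-elim (ne refl)
extract-braid↓ a≢k (pass ne _ (pass _ _ here))    = ⊥-elim (ne refl)
extract-braid↓ a≢k (pass _ ne (pass _ _ (down _))) = ⊥-elim (ne refl)
extract-braid↓ a≢k (pass n₁ n₂ (pass n₃ n₄ (pass _ _ E))) =
  inj₁ (_ , refl , pass n₃ n₄ (pass n₁ n₂ (pass n₃ n₄ E)))

IsReduced : List ℕ → List ℕ → Set
IsReduced e L = ∃ (Word e L)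

isReduced-tail : IsReduced e (a ∷ L) → IsReduced e L
isReduced-tail (_ , _ ∷ W) = _ , W

-- Reducedness of the remainders rules out target `a` at a braid. Of the two inequalities between
-- the counts, the lower bound on the number of moves uses this one.
extract-move : L ⟶ L′ → Extract k L m L₁ → IsReduced e L₁ →
  (∀ {m′ L₁′} → Extract k L′ m′ L₁′ → IsReduced e L₁′) →
  (∃ λ L₁′ → L₁ ⟶ L₁′ × Extract k L′ m L₁′) ⊎ (∃ λ m′ → m ≤ suc m′ × Extract k L′ m′ L₁)
extract-move (comm far) E W W′ with extract-comm far E
... | inj₁ (_ , refl , E′)         = inj₁ (_ , comm far , E′)
... | inj₂ (inj₁ (_ , refl , E′))  = inj₂ (1 , z≤n , E′)
... | inj₂ (inj₂ (refl , E′))      = inj₂ (0 , ≤-refl , E′)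
extract-move {k = k} (braid↑ {a}) E W W′ with a ≟ k
-- Here deletion from `suc a`, `a`, `suc a` leaves the square `suc a`, `suc a`.
... | yes refl = ⊥-elim (word-no-square (proj₂ (W′ (pass (λ ()) (λ ()) here))))
... | no a≢k with extract-braid↑ a≢k E
...   | inj₁ (_ , refl , E′) = inj₁ (_ , braid↑ , E′)
...   | inj₂ (refl , E′)     = inj₂ (0 , ≤-refl , E′)
extract-move {k = k} (braid↓ {a}) E W W′ with a ≟ k
... | no a≢k with extract-braid↓ a≢k E
...   | inj₁ (_ , refl , E′) = inj₁ (_ , braid↓ , E′)
...   | inj₂ (refl , E′)     = inj₂ (1 , z≤n , E′)
extract-move (braid↓ {a}) E W W′ | yes refl with extract-unique E (pass (λ ()) (λ ()) here)
...   | refl , refl = ⊥-elim (word-no-square (proj₂ W))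
extract-move (there mv) here           W W′ = inj₁ (_ , mv , here)
extract-move (there mv) (down E)       W W′
  with extract-move mv E (isReduced-tail W) (λ E′ → isReduced-tail (W′ (down E′)))
... | inj₁ (_ , mv′ , E′) = inj₁ (_ , there mv′ , down E′)
... | inj₂ (_ , le , E′)  = inj₂ (_ , le , down E′)
extract-move (there mv) (pass n₁ n₂ E) W W′
  with extract-move mv E (isReduced-tail W) (λ E′ → isReduced-tail (W′ (pass n₁ n₂ E′)))
... | inj₁ (_ , mv′ , E′) = inj₁ (_ , there mv′ , pass n₁ n₂ E′)
... | inj₂ (_ , le , E′)  = inj₂ (_ , s≤s le , pass n₁ n₂ E′)

-- Twin k w w′: w = A x G y H and w′ = A y G x H with |A| = k - 1, y < x,
-- all of G above x and all of H above y. Undoing descents of w keeps this shape,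
-- with k following x, until x and y become adjacent and are exchanged themselves.
data TwinTail (x y : ℕ) : List ℕ → List ℕ → Set where
  here  : All (y <_) t → TwinTail x y (y ∷ t) (x ∷ t)
  there : x < z → TwinTail x y w w′ → TwinTail x y (z ∷ w) (z ∷ w′)

data Twin : ℕ → List ℕ → List ℕ → Set where
  here  : y < x → TwinTail x y w w′ → Twin 1 (x ∷ w) (y ∷ w′)
  there : Twin k w w′ → Twin (suc k) (z ∷ w) (z ∷ w′)

All-step : ∀ {Q : ℕ → Set} → Step k u w → All Q w → All Q u
All-step (here _)  (q₁ ∷ q₂ ∷ qs) = q₂ ∷ q₁ ∷ qs
All-step (there s) (q₁ ∷ qs)      = q₁ ∷ All-step s qs

-- Entries before the differing place exceed x, and those after it exceed y. Hence y can only move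
-- left, past an entry that also exceeds x, and every descent undone in `w` is one of `w′`.
twinTail-undo : y < x → TwinTail x y w w′ → Step k u w → ∃ λ u′ → TwinTail x y u u′ × Step k u′ w′
twinTail-undo y<x (here (y<z ∷ _))             (here z<y)  = ⊥-elim (<-asym y<z z<y)
twinTail-undo y<x (here ps)                    (there s)   = _ , here (All-step s ps) , there s
twinTail-undo y<x (there x<z (here ps))        (here _)    = _ , here (<-trans y<x x<z ∷ ps) , here x<z
twinTail-undo y<x (there x<z (there x<z′ T))   (here lt)   = _ , there x<z′ (there x<z T) , here lt
twinTail-undo y<x (there x<z T)                (there s) with twinTail-undo y<x T s
... | _ , T′ , s′ = _ , there x<z T′ , there s′

twin-positive : Twin k w w′ → 0 < k
twin-positive (here _ _) = s≤s z≤n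
twin-positive (there _)  = s≤s z≤n

-- The cases match the constructors `here`, `down` and `pass` of `Extract`: x meets y, x moves left
-- past a larger entry, or x stays in place.
twin-undo : Twin k w w′ → Step a u w →
  (a ≡ k × u ≡ w′) ⊎
  (suc a ≡ k × ∃ λ u′ → Twin a u u′ × Step a u′ w′) ⊎
  (a ≢ k × suc a ≢ k × ∃ λ u′ → Twin k u u′ × Step a u′ w′)
twin-undo (here y<x (here ps))     (here _)   = inj₁ (refl , refl)
twin-undo (here y<x (there x<z T)) (here z<x) = ⊥-elim (<-asym x<z z<x)
twin-undo (here y<x T) (there s) with twinTail-undo y<x T s
... | _ , T′ , s′ = inj₂ (inj₂
  ( (λ eq → <⇒≢ (step-positive s) (sym (suc-injective eq)))
  , (λ ()) , _ , here y<x T′ , there s′))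
twin-undo (there (here y<x T))   (here x<z) = inj₂ (inj₁ (refl , _ , here y<x (there x<z T) , here (<-trans y<x x<z)))
twin-undo (there (there T))      (here lt)  = inj₂ (inj₂
  ( (λ ()) , (λ eq → <⇒≢ (twin-positive T) (suc-injective (suc-injective eq)))
  , _ , there (there T) , here lt))
twin-undo (there T)              (there s) with twin-undo T s
... | inj₁ (refl , refl)                       = inj₁ (refl , refl)
... | inj₂ (inj₁ (refl , _ , T′ , s′))         = inj₂ (inj₁ (refl , _ , there T′ , there s′))
... | inj₂ (inj₂ (n₁ , n₂ , _ , T′ , s′))      =
  inj₂ (inj₂ (n₁ ∘ suc-injective , n₂ ∘ suc-injective , _ , there T′ , there s′))

twinTail-above : Increasing (x ∷ w) → TwinTail x y w w′ → x < y
twinTail-above ((x<y ∷ _) ∷ _)          (here _)    = x<y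
twinTail-above ((_ ∷ xs) ∷ _ ∷ inc)     (there _ T) = twinTail-above (xs ∷ inc) T

twin-not-increasing : Increasing w → ¬ Twin k w w′
twin-not-increasing inc       (here y<x T) = <-asym y<x (twinTail-above inc T)
twin-not-increasing (_ ∷ inc) (there T)    = twin-not-increasing inc T

-- This is the exchange condition. In the increasing starting list x cannot precede the smaller y,
-- so some letter exchanges them; omitting it yields a word for `w′`.
twin-exchange : Increasing e → Twin k w w′ → Word e L w → ∃₂ λ m L₁ → Extract k L m L₁ × Word e L₁ w′
twin-exchange inc T []      = ⊥-elim (twin-not-increasing inc T)
twin-exchange inc T (s ∷ W) with twin-undo T s
... | inj₁ (refl , refl) = _ , _ , here , W
... | inj₂ (inj₁ (refl , _ , T′ , s′)) with twin-exchange inc T′ W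
...   | _ , _ , E , W′ = _ , _ , down E , s′ ∷ W′
twin-exchange inc T (s ∷ W) | inj₂ (inj₂ (n₁ , n₂ , _ , T′ , s′)) with twin-exchange inc T′ W
...   | _ , _ , E , W′ = _ , _ , pass n₁ n₂ E , s′ ∷ W′

step-twin : Step k u w → Increasing (drop k w) → Twin k w u
step-twin (here x<y) (ps ∷ _) = here x<y (here ps)
step-twin (there s)  inc      = there (step-twin s inc)

exchange : Increasing e → Step k u w → Increasing (drop k w) → Word e L w →
  ∃₂ λ m L₁ → Extract k L m L₁ × Word e L₁ u
exchange inc s inc′ = twin-exchange inc (step-twin s inc′)

-- Super-Yamanouchi words

-- Inserted k v t w: w is t with the entry v inserted at (1-based) position k.
data Inserted : ℕ → ℕ → List ℕ → List ℕ → Set where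
  here  : Inserted 1 v t (v ∷ t)
  there : Inserted k v t w → Inserted (suc k) v (x ∷ t) (x ∷ w)

inserted-positive : Inserted k v t w → 0 < k
inserted-positive here      = s≤s z≤n
inserted-positive (there _) = s≤s z≤n

step-inserted : Step k u w → ∃₂ λ v t → Inserted k v t w × Inserted (suc k) v t u
step-inserted (here _)  = _ , _ , here , there here
step-inserted (there s) with step-inserted s
... | _ , _ , I , I′ = _ , _ , there I , there I′

inserted-undo : Step k u w → Inserted k v t w → Inserted (suc k) v t u
inserted-undo (here _)   here       = there here
inserted-undo (there s)  (there I)  = there (inserted-undo s I)
inserted-undo (there ()) here
inserted-undo (here _)   (there ())

inserted-redo : Step k u w → Inserted (suc k) v t u → Inserted k v t w
inserted-redo (here _)   (there here)       = here
inserted-redo (here _)   (there (there ()))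
inserted-redo (there s)  (there I)          = there (inserted-redo s I)

All-inserted : ∀ {Q : ℕ → Set} → Inserted k v t w → All Q w → All Q t
All-inserted here      (_ ∷ qs) = qs
All-inserted (there I) (q ∷ qs) = q ∷ All-inserted I qs

increasing-remove : z < k → Inserted k v t w → Increasing (drop z w) → Increasing (drop z t)
increasing-remove {zero}  z<k       here      (_ ∷ inc)  = inc
increasing-remove {zero}  z<k       (there I) (ps ∷ inc) = All-inserted I ps ∷ increasing-remove (inserted-positive I) I inc
increasing-remove {suc z} (s≤s z<k) (there I) inc        = increasing-remove z<k I inc

increasing-insert : z < k → Inserted k v t w → Increasing (drop z t) → Increasing (drop k w)
increasing-insert {zero}  z<k       here      inc       = inc
increasing-insert {zero}  z<k       (there I) (_ ∷ inc) = increasing-insert (inserted-positive I) I inc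
increasing-insert {suc z} (s≤s z<k) (there I) inc       = increasing-insert z<k I inc
increasing-insert {suc z} (s≤s ())  here      inc

-- x heads the first run and z heads the second one (0 if there is none);
-- the letters of a run increase from its head, so heads are minima.
data Runs : ℕ → ℕ → List ℕ → Set where
  one : 0 < x → Runs x 0 (x ∷ [])
  new : y < x → Runs y z L → Runs x y (x ∷ L)
  ext : z < x → Runs (suc x) z L → Runs x z (x ∷ L)

data SY : List ℕ → Set where
  nil  : SY []
  cons : Runs x z L → SY L

runs-< : Runs x z L → z < x
runs-< (one lt)   = lt
runs-< (new lt _) = lt
runs-< (ext lt _) = lt

sy-tail : Runs x z (k ∷ L) → SY L
sy-tail (one _)   = nil
sy-tail (new _ R) = cons R
sy-tail (ext _ R) = cons R

runs-head : Runs x z (k ∷ L) → x ≡ k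
runs-head (one _)   = refl
runs-head (new _ _) = refl
runs-head (ext _ _) = refl

-- The letters of the first run carry one entry v to position `x` and keep the order of all others.
-- Before the run the list increases after position `z`, by induction or because it is the starting
-- list, and deleting v preserves this.
runs-inserted : Increasing e → Runs x z L → Word e L w →
  ∃₂ λ v t → Inserted x v t w × Increasing (drop z t)
runs-inserted inc (one lt) (s ∷ []) with step-inserted s
... | _ , _ , I , I′ = _ , _ , I , increasing-remove (s≤s z≤n) I′ inc
runs-inserted inc (new y<x R) (s ∷ W) with runs-inserted inc R W | step-inserted s
... | _ , _ , I₀ , inc₀ | _ , _ , I , I′ =
  _ , _ , I , increasing-remove (m<n⇒m<1+n y<x) I′ (increasing-insert (runs-< R) I₀ inc₀)
runs-inserted inc (ext _ R) (s ∷ W) with runs-inserted inc R W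
... | _ , _ , I , inc₀ = _ , _ , inserted-redo s I , inc₀

-- The first letter is thus the last descent of `w`, which gives `exchange` its hypothesis and makes
-- the word unique.
runs-increasing : Increasing e → Runs x z L → Word e L w → Increasing (drop x w)
runs-increasing inc R W with runs-inserted inc R W
... | _ , _ , I , inc₀ = increasing-insert (runs-< R) I inc₀

sy-unique : Increasing e → SY L → SY P → Word e L w → Word e P w → L ≡ P
sy-unique inc _ _ [] [] = refl
sy-unique inc _ _ [] (s ∷ _) = ⊥-elim (no-descent inc s)
sy-unique inc _ _ (s ∷ _) [] = ⊥-elim (no-descent inc s)
sy-unique inc (cons R) (cons R′) (s ∷ W) (s′ ∷ W′)
  with refl ← runs-head R | refl ← runs-head R′
  -- Each head is a descent of `w`, and no descent lies beyond the other head.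
  with refl ← ≤-antisym (descent-≤ s (runs-increasing inc R′ (s′ ∷ W′)))
                        (descent-≤ s′ (runs-increasing inc R (s ∷ W)))
  with refl ← step-injective s s′
  = cong (_ ∷_) (sy-unique inc (sy-tail R) (sy-tail R′) W W′)

-- Existence of the distance and its change under a move

sy-exchange : Increasing e → SY (k ∷ P) → Step k u w → Word e P u → Word e L w →
  ∃₂ λ m L₁ → Extract k L m L₁ × Word e L₁ u
sy-exchange inc (cons R) s V with refl ← runs-head R = exchange inc s (runs-increasing inc R (s ∷ V))

dist-exists : Increasing e → SY P → Word e P w → Word e L w → ∃ (Dist L P)
dist-exists inc S []      W with refl ← word-of-increasing inc W = 0 , []
dist-exists inc S@(cons R) (s ∷ V) W with sy-exchange inc S s V W
... | _ , _ , E , W′ with dist-exists inc (sy-tail R) V W′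
...   | _ , Δ = _ , E ∷ Δ

-- A move that survives the deletion is handed on to the later scans; otherwise the remainders agree
-- and only the current count differs.
dist-move : Increasing e → SY P → Word e P w → Word e L w → L ⟶ L′ → Dist L P N →
  ∃ λ N′ → Dist L′ P N′ × N ≤ suc N′
dist-move inc S          []      W mv Δ with word-of-increasing inc W
dist-move inc S          []      W () Δ | refl
dist-move {L′ = L′} inc S@(cons R) (s ∷ V) W mv (E ∷ Δ)
  with sy-exchange inc S s V W | sy-exchange inc S s V (word-move mv W)
... | _ , _ , E₀ , W₀ | _ , _ , E₁ , W₁
  with refl , refl ← extract-unique E E₀
  -- By uniqueness, every deletion from `L′` is the one given by `sy-exchange`, whose remainder is
  -- reduced.
  with extract-move mv E (_ , W₀) (λ E′ → subst (IsReduced _) (proj₂ (extract-unique E₁ E′)) (_ , W₁))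
... | inj₂ (_ , le , E′)   = _ , E′ ∷ Δ , +-monoˡ-≤ _ le
... | inj₁ (_ , mv′ , E′) with dist-move inc (sy-tail R) V W₀ mv′ Δ
...   | _ , Δ′ , le = _ , E′ ∷ Δ′ , ≤-trans (+-monoʳ-≤ _ le) (≤-reflexive (+-suc _ _))

-- Descending moves

-- Sift D L L′: L is β, D, D+1, …, p-1, a, α with β > D, a ≥ D and a ∉ {p-1, p}, and
-- L′ arises by letting a slip past p-1, with a braid move if a = p-2.
-- In BlockSift the block starts at q.
data BlockSift (D : ℕ) : ℕ → List ℕ → List ℕ → Set where
  comm  : D ≤ a → Far q a → BlockSift D q (q ∷ a ∷ L) (a ∷ q ∷ L)
  braid : BlockSift D q (q ∷ suc q ∷ q ∷ L) (suc q ∷ q ∷ suc q ∷ L)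
  there : BlockSift D (suc q) L L′ → BlockSift D q (q ∷ L) (q ∷ L′)

data Sift (D : ℕ) : List ℕ → List ℕ → Set where
  block : BlockSift D D L L′ → Sift D L L′
  there : D < h → Sift D L L′ → Sift D (h ∷ L) (h ∷ L′)

blockSift-move : BlockSift D q L L′ → L ⟶ L′
blockSift-move (comm _ far) = comm far
blockSift-move braid        = braid↑
blockSift-move (there B)    = there (blockSift-move B)

sift-move : Sift D L L′ → L ⟶ L′
sift-move (block B)   = blockSift-move B
sift-move (there _ S) = there (sift-move S)

-- The hypothesis propagates: either `q` lowers the target to `q`, or the target is not `suc q`; so
-- it never equals the next block letter. Only the sifted letter can be paired, and it then has one
-- letter fewer to pass.
extract-blockSift : k ≢ q → BlockSift D q L L′ → Extract k L m L₁ →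
  (∃ λ L₁′ → BlockSift D q L₁ L₁′ × Extract k L′ m L₁′) ⊎ (∃ λ m′ → m ≡ suc m′ × Extract k L′ m′ L₁)
extract-blockSift k≢q (comm le far) E with extract-comm far E
... | inj₁ (_ , refl , E′)       = inj₁ (_ , comm le far , E′)
... | inj₂ (inj₁ (eq , _ , _))   = ⊥-elim (k≢q eq)
... | inj₂ (inj₂ (refl , E′))    = inj₂ (_ , refl , E′)
extract-blockSift k≢q braid E with extract-braid↑ (k≢q ∘ sym) E
... | inj₁ (_ , refl , E′)       = inj₁ (_ , braid , E′)
... | inj₂ (refl , E′)           = inj₂ (_ , refl , E′)
extract-blockSift k≢q (there B) here = ⊥-elim (k≢q refl)
extract-blockSift k≢q (there B) (down E) with extract-blockSift (λ ()) B E
... | inj₁ (_ , B′ , E′)         = inj₁ (_ , there B′ , down E′)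
... | inj₂ (_ , refl , E′)       = inj₂ (_ , refl , down E′)
extract-blockSift k≢q (there B) (pass n₁ n₂ E) with extract-blockSift (n₂ ∘ sym) B E
... | inj₁ (_ , B′ , E′)         = inj₁ (_ , there B′ , pass n₁ n₂ E′)
... | inj₂ (_ , refl , E′)       = inj₂ (_ , refl , pass n₁ n₂ E′)

-- A letter before the block can lower the target only to its own value, which exceeds `D`. So the
-- block is entered with a target different from `D`.
extract-sift : D < k → Sift D L L′ → Extract k L m L₁ →
  (∃ λ L₁′ → Sift D L₁ L₁′ × Extract k L′ m L₁′) ⊎ (∃ λ m′ → m ≡ suc m′ × Extract k L′ m′ L₁)
extract-sift D<k (block B) E with extract-blockSift (<⇒≢ D<k ∘ sym) B E
... | inj₁ (_ , B′ , E′)   = inj₁ (_ , block B′ , E′)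
... | inj₂ r               = inj₂ r
extract-sift D<k (there D<h S) here = inj₁ (_ , S , here)
extract-sift D<k (there D<h S) (down E) with extract-sift D<h S E
... | inj₁ (_ , S′ , E′)   = inj₁ (_ , there D<h S′ , down E′)
... | inj₂ (_ , refl , E′) = inj₂ (_ , refl , down E′)
extract-sift D<k (there D<h S) (pass n₁ n₂ E) with extract-sift D<k S E
... | inj₁ (_ , S′ , E′)   = inj₁ (_ , there D<h S′ , pass n₁ n₂ E′)
... | inj₂ (_ , refl , E′) = inj₂ (_ , refl , pass n₁ n₂ E′)

-- A descent avoiding v survives its removal: at `a` if it lies left of v, and at `a - 1`, which is
-- at least `p`, if it lies right.
inserted-descent : Inserted p v t w → Step a u w → a ≢ p → suc a ≢ p →
  ∃₂ λ a′ t′ → Step a′ t′ t × (a ≤ a′ ⊎ p ≤ a′)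
inserted-descent here      (here _)   n₁ n₂ = ⊥-elim (n₁ refl)
inserted-descent here      (there s)  n₁ n₂ = _ , _ , s , inj₂ (step-positive s)
inserted-descent (there here)      (here _)  n₁ n₂ = ⊥-elim (n₂ refl)
inserted-descent (there (there I)) (here lt) n₁ n₂ = _ , _ , here lt , inj₁ ≤-refl
inserted-descent (there I) (there s) n₁ n₂ with inserted-descent I s (n₁ ∘ cong suc) (n₂ ∘ cong suc)
... | _ , _ , s′ , le = _ , _ , there s′ , Sum.map s≤s s≤s le

-- Undoing the block letters moves v right past the other entries. The sifted letter then exchanges
-- two entries different from v, which exposes a descent of `t` beyond `d`.
blockSift-not-increasing : suc d ≤ q → BlockSift (suc d) q L L′ → Word e L w → Inserted q v t w →
  ¬ Increasing (drop d t)
blockSift-not-increasing d<q (comm d<a far) (s ∷ s′ ∷ _) I inc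
  with inserted-descent (inserted-undo s I) s′ (far⇒suc≢ far ∘ sym) (far⇒≢ far ∘ sym ∘ suc-injective)
... | _ , _ , r , inj₁ le = <⇒≱ (<-≤-trans d<a le) (descent-≤ r inc)
... | _ , _ , r , inj₂ le = <⇒≱ (<-≤-trans (m<n⇒m<1+n d<q) le) (descent-≤ r inc)
blockSift-not-increasing d<q braid (s ∷ s′ ∷ s″ ∷ _) I inc
  with inserted-descent (inserted-undo s′ (inserted-undo s I)) s″ (λ ()) (λ ())
... | _ , _ , r , inj₁ le = <⇒≱ (<-≤-trans d<q le) (descent-≤ r inc)
... | _ , _ , r , inj₂ le = <⇒≱ (<-≤-trans (m<n⇒m<1+n (m<n⇒m<1+n d<q)) le) (descent-≤ r inc)
blockSift-not-increasing d<q (there B) (s ∷ W) I inc =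
  blockSift-not-increasing (m<n⇒m<1+n d<q) B W (inserted-undo s I) inc

inserted-drop : Inserted (suc d) v t w → drop (suc d) w ≡ drop d t
inserted-drop here              = refl
inserted-drop (there {suc d} I) = inserted-drop I
inserted-drop (there {zero} ())

increasing-drop : k ≤ d → Increasing (drop k w) → Increasing (drop d w)
increasing-drop {d = zero}              z≤n      inc       = inc
increasing-drop {d = suc d} {w = []}    z≤n      inc       = []
increasing-drop {d = suc d} {w = x ∷ w} z≤n      (_ ∷ inc) = increasing-drop {d = d} z≤n inc
increasing-drop {w = []}                (s≤s le) inc       = []
increasing-drop {w = x ∷ w}             (s≤s le) inc       = increasing-drop le inc

blockSift-step : BlockSift D q L L′ → Word e L w → ∃ λ u → Step q u w
blockSift-step (comm _ _) (s ∷ _) = _ , s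
blockSift-step braid      (s ∷ _) = _ , s
blockSift-step (there _)  (s ∷ _) = _ , s

-- A letter before the block is above `D`, and the first one is a descent of `w`. If instead the
-- word starts with the block and `w` increased after `D`, deleting entry number `D` would
-- contradict `blockSift-not-increasing`.
sift-below-descent : Sift D L L′ → Word e L w → Increasing (drop k w) → D < k
sift-below-descent (there D<h S) (s ∷ W) inc = <-≤-trans D<h (descent-≤ s inc)
-- Letters of a word are positive, so no block starts at 0.
sift-below-descent {zero} (block B) W inc with _ , () ← blockSift-step B W
sift-below-descent {suc d} {k = k} (block B) W inc with suc d <? k | blockSift-step B W
... | yes lt | _     = lt
... | no  ge | _ , s with step-inserted s
...   | _ , _ , I , _ = ⊥-elim (blockSift-not-increasing ≤-refl B W I
          (subst Increasing (inserted-drop I) (increasing-drop (≮⇒≥ ge) inc)))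

-- The target of each scan is the last descent of the current permutation, hence above `D`. The sift
-- survives the scans until one of them loses exactly one passed letter.
dist-sift : Increasing e → SY P → Word e P w → Word e L w → Sift D L L′ → Dist L P N →
  ∃ λ N′ → N ≡ suc N′ × Dist L′ P N′
dist-sift inc S [] W sf Δ with word-of-increasing inc W | sift-move sf
dist-sift inc S [] W sf Δ | refl | ()
dist-sift inc S@(cons R) (s ∷ V) W sf (E ∷ Δ)
  with refl ← runs-head R
  with _ , _ , E₀ , W₀ ← sy-exchange inc S s V W
  with refl , refl ← extract-unique E E₀
  with extract-sift (sift-below-descent sf W (runs-increasing inc R (s ∷ V))) sf E
... | inj₂ (_ , refl , E′) = _ , refl , E′ ∷ Δ
... | inj₁ (_ , sf′ , E′) with dist-sift inc (sy-tail R) V W₀ sf′ Δ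
...   | _ , refl , Δ′ = _ , +-suc _ _ , E′ ∷ Δ′

-- Finding a descending move

SYBelow : ℕ → List ℕ → Set
SYBelow D P = P ≡ [] ⊎ (∃₂ λ x z → x < D × Runs x z P)

-- The block is followed while the next letter is one larger. Equality with `q` would be a square
-- and `suc a ≡ q` is excluded, so any other letter is far. After a longer block the excluded letter
-- is the one that completes a braid.
sy-or-blockSift : ∀ L → 0 < D → D ≤ q → All (D ≤_) L → (∀ {a L₂} → L ≡ a ∷ L₂ → suc a ≢ q) →
  SYBelow D P → IsReduced e (q ∷ L ++ P) →
  (∃ λ z → z < D × Runs q z (q ∷ L ++ P)) ⊎ (∃ λ L′ → BlockSift D q (q ∷ L ++ P) L′)
sy-or-blockSift [] 0<D D≤q _ _ (inj₁ refl) _              = inj₁ (0 , 0<D , one (<-≤-trans 0<D D≤q))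
sy-or-blockSift [] 0<D D≤q _ _ (inj₂ (x , z , x<D , R)) _ = inj₁ (x , x<D , new (<-≤-trans x<D D≤q) R)
sy-or-blockSift {q = q} (a ∷ L) 0<D D≤q (D≤a ∷ D≤L) a≢q-1 S W with a ≟ suc q
sy-or-blockSift {q = q} (a ∷ L) 0<D D≤q (D≤a ∷ D≤L) a≢q-1 S W | no a≢q+1 with a ≟ q
... | yes refl = ⊥-elim (word-no-square (proj₂ W))
... | no a≢q   = inj₂ (_ , comm D≤a (far-intro (a≢q ∘ sym) (a≢q+1 ∘ sym) (a≢q-1 refl)))
sy-or-blockSift {D} {q} {P} {e} (a ∷ L) 0<D D≤q (D≤a ∷ D≤L) a≢q-1 S W | yes refl = next L D≤L W
  where
  continue : ∀ L → All (D ≤_) L → (∀ {a L₂} → L ≡ a ∷ L₂ → suc a ≢ suc q) →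
    IsReduced e (q ∷ suc q ∷ L ++ P) →
    (∃ λ z → z < D × Runs q z (q ∷ suc q ∷ L ++ P)) ⊎ (∃ λ L′ → BlockSift D q (q ∷ suc q ∷ L ++ P) L′)
  continue L D≤L ne W with sy-or-blockSift L 0<D (m≤n⇒m≤1+n D≤q) D≤L ne S (isReduced-tail W)
  ... | inj₁ (z , z<D , R) = inj₁ (z , z<D , ext (<-≤-trans z<D D≤q) R)
  ... | inj₂ (_ , B)       = inj₂ (_ , there B)
  next : ∀ L → All (D ≤_) L → IsReduced e (q ∷ suc q ∷ L ++ P) →
    (∃ λ z → z < D × Runs q z (q ∷ suc q ∷ L ++ P)) ⊎ (∃ λ L′ → BlockSift D q (q ∷ suc q ∷ L ++ P) L′)
  next []       D≤L W = continue [] D≤L (λ ()) W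
  next (a ∷ L)  D≤L W with a ≟ q
  ... | yes refl = inj₂ (_ , braid)
  ... | no a≢q   = continue (a ∷ L) D≤L (λ where refl → a≢q ∘ suc-injective) W

first-minimum : All (D ≤_) L → All (D <_) L ⊎ (∃₂ λ β L₂ → L ≡ β ++ D ∷ L₂ × All (D <_) β × All (D ≤_) L₂)
first-minimum []                = inj₁ []
first-minimum {D} (_∷_ {x} D≤x ps) with D ≟ x
... | yes refl = inj₂ ([] , _ , refl , [] , ps)
... | no D≢x with first-minimum ps
...   | inj₁ qs                        = inj₁ (≤∧≢⇒< D≤x D≢x ∷ qs)
...   | inj₂ (β , L₂ , refl , qs , ps′) = inj₂ (_ ∷ β , L₂ , refl , ≤∧≢⇒< D≤x D≢x ∷ qs , ps′)

sift-prefix : ∀ {β} → All (D <_) β → Sift D L L′ → Sift D (β ++ L) (β ++ L′)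
sift-prefix []       S = S
sift-prefix (lt ∷ ps) S = there lt (sift-prefix ps S)

isReduced-suffix : ∀ β → IsReduced e (β ++ L) → IsReduced e L
isReduced-suffix []      W = W
isReduced-suffix (_ ∷ β) W = isReduced-suffix β (isReduced-tail W)

syBelow⇒sy : SYBelow D P → SY P
syBelow⇒sy (inj₁ refl)            = nil
syBelow⇒sy (inj₂ (_ , _ , _ , R)) = cons R

syBelow-suc : SYBelow D P → SYBelow (suc D) P
syBelow-suc (inj₁ eq)                 = inj₁ eq
syBelow-suc (inj₂ (x , z , x<D , R)) = inj₂ (x , z , m<n⇒m<1+n x<D , R)

-- `i` bounds the values of `D` still to be treated. A block that reaches the finished tail joins
-- it, and all letters before it exceed `D`.
sy-or-sift-from : ∀ i → n ≤ i + D → 0 < D → All (D ≤_) L → All (_< n) L → SYBelow D P →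
  IsReduced e (L ++ P) → SY (L ++ P) ⊎ (∃₂ λ D′ L′ → Sift D′ (L ++ P) L′)
sy-or-sift-from zero    n≤D 0<D []          _           S W = inj₁ (syBelow⇒sy S)
sy-or-sift-from zero    n≤D 0<D (D≤a ∷ _)   (a<n ∷ _)   S W = ⊥-elim (<⇒≱ a<n (≤-trans n≤D D≤a))
sy-or-sift-from {n} {D} {L} {P} (suc i) n≤ 0<D D≤L L<n S W with first-minimum D≤L
... | inj₁ D<L = sy-or-sift-from i (subst (n ≤_) (sym (+-suc i D)) n≤) (s≤s z≤n) D<L L<n (syBelow-suc S) W
... | inj₂ (β , L₂ , refl , D<β , D≤L₂)
  rewrite ++-assoc β (D ∷ L₂) P
  with sy-or-blockSift L₂ 0<D ≤-refl D≤L₂ (λ where refl eq → <⇒≱ (≤-reflexive eq) (All.head D≤L₂))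
         S (isReduced-suffix β W)
...   | inj₂ (_ , B)       = inj₂ (D , _ , sift-prefix D<β (block B))
...   | inj₁ (z , z<D , R) = sy-or-sift-from i (subst (n ≤_) (sym (+-suc i D)) n≤) (s≤s z≤n)
          D<β (++⁻ˡ β L<n) (inj₂ (D , z , ≤-refl , R)) W

sy-or-sift : Word e L w → SY L ⊎ (∃₂ λ D L′ → Sift D L L′)
sy-or-sift {L = L} {w} W
  with sy-or-sift-from (length w) (m≤m+n (length w) 1) (s≤s z≤n) (All.map proj₁ (word-letters W))
         (All.map proj₂ (word-letters W)) (inj₁ refl) (subst (IsReduced _) (sym (++-identityʳ L)) (_ , W))
... | r rewrite ++-identityʳ L = r

data _⟶[_]_ : List ℕ → ℕ → List ℕ → Set where
  []  : L ⟶[ 0 ] L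
  _∷_ : ∀ {L″} → L ⟶ L′ → L′ ⟶[ N ] L″ → L ⟶[ suc N ] L″

-- Each sift lowers the distance by exactly one, so the path has length `N`; where none exists,
-- uniqueness identifies the word with `P`.
descend : Increasing e → SY P → Word e P w → Word e L w → Dist L P N → L ⟶[ N ] P
descend {N = N} inc S V W Δ with sy-or-sift W
descend {N = N} inc S V W Δ | inj₁ S′
  with refl ← sy-unique inc S′ S W V
  with refl ← dist-unique Δ (dist-refl _) = []
descend {N = zero} inc S V W Δ | inj₂ (_ , _ , sf) with () ← proj₁ (proj₂ (dist-sift inc S V W sf Δ))
descend {N = suc N} inc S V W Δ | inj₂ (_ , _ , sf) with _ , refl , Δ′ ← dist-sift inc S V W sf Δ =
  sift-move sf ∷ descend inc S V (word-move (sift-move sf) W) Δ′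

-- Super-Yamanouchi words in terms of their runs

minL-consecutive : ∀ x r → Consecutive (x ∷ r) → minL (x ∷ r) ≡ x
minL-consecutive x r con = foldr-⊓-≥ r (consecutive-≥ x r con)
  where
  consecutive-≥ : ∀ x r → Consecutive (x ∷ r) → All (x ≤_) r
  consecutive-≥ x []      _            = []
  consecutive-≥ x (_ ∷ r) (refl ∷ con) = n≤1+n x ∷ All.map (≤-trans (n≤1+n x)) (consecutive-≥ (suc x) r con)
  foldr-⊓-≥ : ∀ r → All (x ≤_) r → foldr _⊓_ x r ≡ x
  foldr-⊓-≥ []      []       = refl
  foldr-⊓-≥ (y ∷ r) (p ∷ ps) rewrite foldr-⊓-≥ r ps = m≥n⇒m⊓n≡n p

-- Ties the heads in `Runs` to the computed list of runs, with the same value 0 for a missing second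
-- run.
RunsShape : ℕ → ℕ → List (List ℕ) → Set
RunsShape x z []              = ⊥
RunsShape x z ([] ∷ rs)       = ⊥
RunsShape x z ((y ∷ r) ∷ [])  = x ≡ y × z ≡ 0
RunsShape x z ((y ∷ r) ∷ r′ ∷ rs) = x ≡ y × z ≡ minL r′

SYRuns : List (List ℕ) → Set
SYRuns rs = All Consecutive rs × Linked _>_ (map minL rs)

runs-∷ : ∀ a L → ∃₂ λ r rs → runs (a ∷ L) ≡ (a ∷ r) ∷ rs
runs-∷ a L with runs L
... | []             = _ , _ , refl
... | [] ∷ rs        = _ , _ , refl
... | (y ∷ r) ∷ rs with a <ᵇ y
...   | true  = _ , _ , refl
...   | false = _ , _ , refl

syRuns⇒runs : ∀ a L → All (0 <_) (a ∷ L) → SYRuns (runs (a ∷ L)) →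
  ∃₂ λ x z → Runs x z (a ∷ L) × RunsShape x z (runs (a ∷ L))
syRuns⇒runs a []      (0<a ∷ []) S = a , 0 , one 0<a , refl , refl
syRuns⇒runs a (y ∷ L) (0<a ∷ ps) S with syRuns⇒runs y L ps
... | ih with runs (y ∷ L) | runs-∷ y L
...   | .((y ∷ r) ∷ rs) | r , rs , refl with a <? y
syRuns⇒runs a (y ∷ L) (0<a ∷ ps) S | ih | _ | r , rs , refl | no a≮y
  rewrite ≮⇒<ᵇ≡false a≮y
  with _ ∷ con ∷ cons′ , min< ∷ lk ← S
  with ih (con ∷ cons′ , lk)
... | x , z , R , shape
  with refl ← runs-head R
  = a , y , new (subst (_< a) (minL-consecutive y r con) min<) R , refl , sym (minL-consecutive y r con)
syRuns⇒runs a (y ∷ L) (0<a ∷ ps) S | ih | _ | r , [] , refl | yes a<y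
  rewrite <⇒<ᵇ≡true a<y
  with (refl ∷ con) ∷ cons′ , _ ← S
  with _ , _ , R , refl , refl ← ih (con ∷ cons′ , [-])
  = a , 0 , ext 0<a R , refl , refl
syRuns⇒runs a (y ∷ L) (0<a ∷ ps) S | ih | _ | r , r′ ∷ rs , refl | yes a<y
  rewrite <⇒<ᵇ≡true a<y
  with (refl ∷ con) ∷ cons′ , min< ∷ lk ← S
  with lt ← subst (minL r′ <_) (minL-consecutive a (y ∷ r) (refl ∷ con)) min<
  -- Without `a` the first run starts at `suc a`, so the bound on the next minimum is weakened by
  -- one.
  with _ , _ , R , refl , refl ← ih (con ∷ cons′ ,
         subst (minL r′ <_) (sym (minL-consecutive y r con)) (m<n⇒m<1+n lt) ∷ lk)
  = a , minL r′ , ext lt R , refl , refl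

superYamanouchi⇒sy : Word e L w → SuperYamanouchiWritten L → SY L
superYamanouchi⇒sy []          S = nil
superYamanouchi⇒sy W@(_ ∷ _)   S = cons (proj₁ (proj₂ (proj₂ (syRuns⇒runs _ _ (All.map proj₁ (word-letters W)) S))))

-- Coxeter moves in storage order

move-++ʳ : ∀ B → L ⟶ L′ → L ++ B ⟶ L′ ++ B
move-++ʳ B (comm far) = comm far
move-++ʳ B braid↑     = braid↑
move-++ʳ B braid↓     = braid↓
move-++ʳ B (there mv) = there (move-++ʳ B mv)

move-++ˡ : ∀ A → L ⟶ L′ → A ++ L ⟶ A ++ L′
move-++ˡ []      mv = mv
move-++ˡ (_ ∷ A) mv = there (move-++ˡ A mv)

move-reverse : L ⟶ L′ → reverse L ⟶ reverse L′
move-reverse (comm {a} {d} {L} far)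
  rewrite reverse-++ (a ∷ d ∷ []) L | reverse-++ (d ∷ a ∷ []) L = move-++ˡ (reverse L) (comm (far-sym far))
move-reverse (braid↑ {a} {L})
  rewrite reverse-++ (a ∷ suc a ∷ a ∷ []) L | reverse-++ (suc a ∷ a ∷ suc a ∷ []) L = move-++ˡ (reverse L) braid↑
move-reverse (braid↓ {a} {L})
  rewrite reverse-++ (a ∷ suc a ∷ a ∷ []) L | reverse-++ (suc a ∷ a ∷ suc a ∷ []) L = move-++ˡ (reverse L) braid↓
move-reverse (there {L} {L′} {a} mv)
  rewrite unfold-reverse a L | unfold-reverse a L′ = move-++ʳ (a ∷ []) (move-reverse mv)

move-length : L ⟶ L′ → length L ≡ length L′
move-length (comm _)   = refl
move-length braid↑     = refl
move-length braid↓     = refl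
move-length (there mv) = cong suc (move-length mv)

≡ᵇ-refl : ∀ k → (k ≡ᵇ k) ≡ true
≡ᵇ-refl zero    = refl
≡ᵇ-refl (suc k) = ≡ᵇ-refl k

≢⇒≡ᵇ≡false : x ≢ y → (x ≡ᵇ y) ≡ false
≢⇒≡ᵇ≡false {x} {y} x≢y with x ≡ᵇ y | ≡ᵇ⇒≡ x y
... | true  | f = ⊥-elim (x≢y (f _))
... | false | _ = refl

applyMove-complete : L ⟶ L′ → ∃ λ (g : Move (length L)) → applyMove g L ≡ L′
applyMove-complete (comm {a} {d} {L} far) = c 1 ≤-refl (s≤s (s≤s z≤n)) , eq far
  where
  eq : Far a d → cAt 0 (a ∷ d ∷ L) ≡ d ∷ a ∷ L
  eq (inj₁ lt) rewrite <⇒<ᵇ≡true lt = refl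
  eq (inj₂ lt) rewrite <⇒<ᵇ≡true lt | ∨-zeroʳ (suc a <ᵇ d) = refl
-- A braid move is indexed by its middle letter, hence 2 at the head of the list.
applyMove-complete (braid↑ {a} {L}) = b 2 ≤-refl (s≤s (s≤s (s≤s z≤n))) , eq
  where
  eq : bAt 0 (a ∷ suc a ∷ a ∷ L) ≡ suc a ∷ a ∷ suc a ∷ L
  eq rewrite ≡ᵇ-refl a = refl
applyMove-complete (braid↓ {a} {L}) = b 2 ≤-refl (s≤s (s≤s (s≤s z≤n))) , eq
  where
  eq : bAt 0 (suc a ∷ a ∷ suc a ∷ L) ≡ a ∷ suc a ∷ a ∷ L
  eq rewrite ≡ᵇ-refl a | ∨-zeroʳ (a ≡ᵇ suc (suc a)) = refl
applyMove-complete (there mv) with applyMove-complete mv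
... | c (suc i) _ lt       , eq = c (suc (suc i)) (s≤s z≤n) (s≤s lt) , cong (_ ∷_) eq
... | b (suc (suc i)) _ lt , eq = b (suc (suc (suc i))) (s≤s (s≤s z≤n)) (s≤s lt) , cong (_ ∷_) eq
... | b (suc zero) (s≤s ()) _ , _

cAt-sound : ∀ i L → cAt i L ≡ L ⊎ L ⟶ cAt i L
cAt-sound zero    []          = inj₁ refl
cAt-sound zero    (x ∷ [])    = inj₁ refl
cAt-sound zero    (x ∷ y ∷ L) with suc x <ᵇ y in eq | suc y <ᵇ x in eq′
... | true  | _     = inj₂ (comm (inj₁ (<ᵇ⇒< (suc x) y (subst T (sym eq) _))))
... | false | true  = inj₂ (comm (inj₂ (<ᵇ⇒< (suc y) x (subst T (sym eq′) _))))
... | false | false = inj₁ refl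
cAt-sound (suc i) []          = inj₁ refl
cAt-sound (suc i) (x ∷ L)     = Sum.map (cong (x ∷_)) there (cAt-sound i L)

bAt-sound : ∀ i L → bAt i L ≡ L ⊎ L ⟶ bAt i L
bAt-sound zero    []              = inj₁ refl
bAt-sound zero    (x ∷ [])        = inj₁ refl
bAt-sound zero    (x ∷ y ∷ [])    = inj₁ refl
bAt-sound zero    (x ∷ y ∷ z ∷ L) with x ≡ᵇ z in eq
... | false = inj₁ refl
... | true with refl ← ≡ᵇ⇒≡ x z (subst T (sym eq) _) with y ≡ᵇ suc x in eq₁ | x ≡ᵇ suc y in eq₂
...   | false | false = inj₁ refl
...   | true  | _     with refl ← ≡ᵇ⇒≡ y (suc x) (subst T (sym eq₁) _) = inj₂ braid↑
...   | false | true  with refl ← ≡ᵇ⇒≡ x (suc y) (subst T (sym eq₂) _) = inj₂ braid↓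
bAt-sound (suc i) []              = inj₁ refl
bAt-sound (suc i) (x ∷ L)         = Sum.map (cong (x ∷_)) there (bAt-sound i L)

applyMove-sound : ∀ (g : Move n) L → applyMove g L ≡ L ⊎ L ⟶ applyMove g L
applyMove-sound (c i _ _) L = cAt-sound (i ∸ 1) L
applyMove-sound (b i _ _) L = bAt-sound (i ∸ 2) L

applyMoves-complete : L ⟶[ N ] L′ → ∀ {l} → length L ≡ l →
  ∃ λ (gs : List (Move l)) → length gs ≡ N × applyMoves gs (reverse L) ≡ reverse L′
applyMoves-complete []                _  = [] , refl , refl
applyMoves-complete {L} (mv ∷ path) refl
  with applyMove-complete (move-reverse mv) | applyMoves-complete path (sym (move-length mv))
... | g | gs , len , eq rewrite length-reverse L with g
... | g , eq′ = g ∷ gs , cong suc len , trans (cong (applyMoves gs) eq′) eq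

-- An identity move only lengthens the sequence, an effective one lowers the distance by at most
-- one, and at the end the distance is 0.
dist-≤-applyMoves : Increasing e → SY P → Word e P w → ∀ (gs : List (Move n)) ρ →
  Word e (reverse ρ) w → Dist (reverse ρ) P N → SuperYamanouchi (applyMoves gs ρ) → N ≤ length gs
dist-≤-applyMoves inc S V [] ρ W Δ Y
  with refl ← sy-unique inc (superYamanouchi⇒sy W Y) S W V
  with refl ← dist-unique Δ (dist-refl _) = z≤n
dist-≤-applyMoves inc S V (g ∷ gs) ρ W Δ Y with applyMove-sound g ρ
... | inj₁ eq rewrite eq = m≤n⇒m≤1+n (dist-≤-applyMoves inc S V gs ρ W Δ Y)
... | inj₂ mv with _ , Δ′ , le ← dist-move inc S V W (move-reverse mv) Δ =
  ≤-trans le (s≤s (dist-≤-applyMoves inc S V gs (applyMove g ρ) (word-move (move-reverse mv) W) Δ′ Y))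

-- The permutation perm(ρ)

unpaired : List ℕ → List ℕ → List ℕ
unpaired Q []       = []
unpaired Q (j ∷ js) = if memb j Q then unpaired Q js else j ∷ unpaired Q js

unpaired-[] : ∀ js → unpaired [] js ≡ js
unpaired-[] []       = refl
unpaired-[] (j ∷ js) = cong (j ∷_) (unpaired-[] js)

-- Skipping paired positions amounts to deleting them beforehand, which turns the scan into
-- `Extract` on the remaining letters.
scan-unpaired : ∀ ρ k js Q → scan ρ k js Q ≡ scan ρ k (unpaired Q js) []
scan-unpaired ρ k []       Q = refl
scan-unpaired ρ k (j ∷ js) Q with memb j Q
... | true  = scan-unpaired ρ k js Q
... | false rewrite scan-unpaired ρ k js Q | scan-unpaired ρ (k ∸ 1) js Q = refl

unpaired-∷ : ∀ j Q js → unpaired (j ∷ Q) js ≡ unpaired (j ∷ []) (unpaired Q js)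
unpaired-∷ j Q []       = refl
unpaired-∷ j Q (i ∷ js) with memb i Q
... | true rewrite ∨-zeroʳ (j ≡ᵇ i) = unpaired-∷ j Q js
... | false with j ≡ᵇ i
...   | true  = unpaired-∷ j Q js
...   | false = cong (i ∷_) (unpaired-∷ j Q js)

unpaired-absent : All (x ≢_) t → unpaired (x ∷ []) t ≡ t
unpaired-absent []         = refl
unpaired-absent (ne ∷ nes) rewrite ≢⇒≡ᵇ≡false ne = cong (_ ∷_) (unpaired-absent nes)

unpaired-once : ∀ {A B} → All (x ≢_) A → All (x ≢_) B → unpaired (x ∷ []) (A ++ x ∷ B) ≡ A ++ B
unpaired-once {x} []         nes′ rewrite ≡ᵇ-refl x = unpaired-absent nes′
unpaired-once     (ne ∷ nes) nes′ rewrite ≢⇒≡ᵇ≡false ne = cong (_ ∷_) (unpaired-once nes nes′)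

-- Each position in `A` is either counted in `m` or lowers the target by one, and the target
-- descends from `k` to the paired letter.
scan-extract : ∀ ρ J → Extract k (map (at ρ) J) m L₁ →
  ∃ λ A → ∃₂ λ j B → J ≡ A ++ j ∷ B × L₁ ≡ map (at ρ) (A ++ B) ×
    length A + at ρ j ≡ m + k × scan ρ k J [] ≡ just j
scan-extract ρ (j ∷ J) here rewrite ≡ᵇ-refl (at ρ j) = [] , j , J , refl , refl , refl , refl
scan-extract ρ (j ∷ J) (down {m = m} E)
  rewrite ≢⇒≡ᵇ≡false {at ρ j} {suc (at ρ j)} (<⇒≢ (n<1+n _)) | ≡ᵇ-refl (at ρ j) with scan-extract ρ J E
... | A , i , B , refl , refl , eq , sc =
  j ∷ A , i , B , refl , refl , trans (cong suc eq) (sym (+-suc m (at ρ j))) , sc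
-- Since `0 ∸ 1` is 0, both tests of `scan` compare with 0 here.
scan-extract {zero} ρ (j ∷ J) (pass n₁ n₂ E) rewrite ≢⇒≡ᵇ≡false n₁ with scan-extract ρ J E
... | A , i , B , refl , refl , eq , sc = j ∷ A , i , B , refl , refl , cong suc eq , sc
scan-extract {suc k} ρ (j ∷ J) (pass n₁ n₂ E)
  rewrite ≢⇒≡ᵇ≡false n₁ | ≢⇒≡ᵇ≡false (n₂ ∘ cong suc) with scan-extract ρ J E
... | A , i , B , refl , refl , eq , sc = j ∷ A , i , B , refl , refl , cong suc eq , sc

exceeds : ℕ → ℕ → ℕ
exceeds x y = if x <ᵇ y then 1 else 0

-- Written as a sum, so that `sum-↭` gives invariance under rearrangement.
countGreater : ℕ → List ℕ → ℕ
countGreater x t = sum (map (exceeds x) t)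

countLess-∷ʳ : ∀ x t y → countLess x (t ++ y ∷ []) ≡ exceeds y x + countLess x t
countLess-∷ʳ x []      y with y <ᵇ x
... | true  = refl
... | false = refl
countLess-∷ʳ x (z ∷ t) y rewrite countLess-∷ʳ x t y with z <ᵇ x
... | true  = sym (+-suc (exceeds y x) (countLess x t))
... | false = refl

inversions-∷ʳ : ∀ t y → inversions (t ++ y ∷ []) ≡ inversions t + countGreater y t
inversions-∷ʳ []      y = refl
inversions-∷ʳ (x ∷ t) y rewrite countLess-∷ʳ x t y | inversions-∷ʳ t y =
  rearrange (exceeds y x) (countLess x t) (inversions t) (countGreater y t)
  where
  rearrange : ∀ i j l o → (i + j) + (l + o) ≡ (j + l) + (i + o)
  rearrange = ℕ-solver.solve-∀

countGreater-split : ∀ {A B} → All (x <_) A → All (_< x) B → countGreater x (A ++ B) ≡ length A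
countGreater-split (lt ∷ lts) gts rewrite <⇒<ᵇ≡true lt = cong suc (countGreater-split lts gts)
countGreater-split []         []  = refl
countGreater-split []         (gt ∷ gts) rewrite ≮⇒<ᵇ≡false (<-asym gt) = countGreater-split [] gts

decreasing-split : ∀ A {j B} → AllPairs _>_ (A ++ j ∷ B) → All (j <_) A × All (_< j) B × AllPairs _>_ (A ++ B)
decreasing-split []      (ps ∷ dec) = [] , ps , dec
decreasing-split (x ∷ A) (ps ∷ dec) with decreasing-split A dec | ++⁻ʳ A ps
... | lts , gts , dec′ | lt ∷ ps′ = lt ∷ lts , gts , ++⁺ (++⁻ˡ A ps) ps′ ∷ dec′

-- The new value `j` comes last in one-line notation, after the values still unpaired. Those above
-- `j` are exactly the positions in `A`, so `scan-extract` gives its inversions. Moving both letter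
-- sums to opposite sides avoids subtraction.
pairLoop-dist : ∀ ρ π js is Q → AllPairs _>_ (unpaired Q js) →
  Dist (map (at ρ) (unpaired Q js)) (map (at π) is) N →
  ∃ λ r → pairLoop ρ π js is Q ≡ just r × r ↭ unpaired Q js ×
    inversions (reverse r) + sum (map (at ρ) (unpaired Q js)) ≡ N + sum (map (at π) is)
pairLoop-dist ρ π js [] Q dec Δ with unpaired Q js
pairLoop-dist ρ π js [] Q dec [] | [] = [] , refl , ↭-refl , refl
pairLoop-dist ρ π js (i ∷ is) Q dec (_∷_ {m = m} {N = N} E Δ)
  with A , j , B , eqJ , refl , len , sc ← scan-extract ρ (unpaired Q js) E
  rewrite scan-unpaired ρ (at π i) js Q | sc
  with lts , gts , dec′ ← decreasing-split A (subst (AllPairs _>_) eqJ dec)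
  -- Positions are distinct, so pairing `j` leaves exactly `A ++ B`.
  with rest ← trans (unpaired-∷ j Q js) (trans (cong (unpaired (j ∷ [])) eqJ)
                (unpaired-once (All.map <⇒≢ lts) (All.map (λ lt → <⇒≢ lt ∘ sym) gts)))
  with r , eqr , perm , total ← pairLoop-dist ρ π js is (j ∷ Q) (subst (AllPairs _>_) (sym rest) dec′)
         (subst (λ t → Dist (map (at ρ) t) (map (at π) is) N) (sym rest) Δ)
  rewrite rest | eqr | eqJ
  = j ∷ r , refl , ↭-trans (↭-prep j perm) (↭-sym (shift j A B)) , count
  where
  greater : countGreater j (reverse r) ≡ length A
  greater = trans (sum-↭ (map⁺ (exceeds j) (↭-trans (↭-reverse r) perm))) (countGreater-split lts gts)
  rearrange : ∀ I l S f m N k T → I + S ≡ N + T → l + f ≡ m + k → I + l + (f + S) ≡ m + N + (k + T)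
  rearrange I l S f m N k T e₁ e₂ = trans (r₁ I l S f) (trans (cong₂ _+_ e₁ e₂) (r₂ m N k T))
    where
    r₁ : ∀ I l S f → I + l + (f + S) ≡ (I + S) + (l + f)
    r₁ = ℕ-solver.solve-∀
    r₂ : ∀ m N k T → (N + T) + (m + k) ≡ m + N + (k + T)
    r₂ = ℕ-solver.solve-∀
  count : inversions (reverse (j ∷ r)) + sum (map (at ρ) (A ++ j ∷ B)) ≡ m + N + (at π i + sum (map (at π) is))
  count rewrite unfold-reverse j r | inversions-∷ʳ (reverse r) j | greater
              | sum-↭ (map⁺ (at ρ) (shift j A B)) =
    rearrange (inversions (reverse r)) (length A) (sum (map (at ρ) (A ++ B))) (at ρ j) m N (at π i) _ total len

-- The integer formula for inv(ρ)

map-at-idList : ∀ ρ → map (at ρ) (idList (length ρ)) ≡ ρ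
map-at-idList ρ = trans (sym (map-∘ (upTo (length ρ)))) (trans (map-upTo (at ρ ∘ suc) (length ρ)) (letters ρ))
  where
  letters : ∀ ρ → applyUpTo (at ρ ∘ suc) (length ρ) ≡ ρ
  letters []      = refl
  letters (x ∷ ρ) = cong (x ∷_) (letters ρ)

idList-increasing : ∀ n → Increasing (idList n)
idList-increasing n = AllPairsₚ.map⁺ (AllPairsₚ.applyUpTo⁺₁ _ n (λ lt _ → s≤s lt))

idList-decreasing : ∀ n → AllPairs _>_ (reverse (idList n))
idList-decreasing n = subst (AllPairs _>_)
  (sym (trans (sym (reverse-map suc (upTo n))) (cong (map suc) (reverse-upTo n))))
  (AllPairsₚ.map⁺ (AllPairsₚ.applyDownFrom⁺₁ _ n (λ lt _ → s≤s lt)))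

sumDiff-sum : ∀ π ρ → length π ≡ length ρ → sumDiff π ρ ≡ + sum π - + sum ρ
sumDiff-sum []      []      _  = refl
sumDiff-sum (p ∷ π) (r ∷ ρ) eq rewrite sumDiff-sum π ρ (suc-injective eq) =
  rearrange (+ p) (+ r) (+ sum π) (+ sum ρ)
  where
  rearrange : ∀ i j l o → (i - j) ℤ.+ (l - o) ≡ (i ℤ.+ l) - (j ℤ.+ o)
  rearrange = ℤ-solver.solve-∀

permOf-dist : ∀ ρ π → length π ≡ length ρ → Dist (reverse ρ) (reverse π) N →
  ∃ λ v → permOf ρ π ≡ just v × v ↭ idList (length ρ) × + inversions v - sumDiff π ρ ≡ + N
permOf-dist {N} ρ π len Δ =
  reverse r , cong (Maybe.map reverse) eq ,
  ↭-trans (↭-reverse r) (↭-trans perm (↭-trans (↭-reflexive (unpaired-[] js)) (↭-reverse _))) ,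
  trans (cong (λ s → + inversions (reverse r) - s) (sumDiff-sum π ρ len))
    (cancel (inversions (reverse r)) (sum π) (sum ρ) N total′)
  where
  js = reverse (idList (length ρ))
  letters : ∀ σ → length σ ≡ length ρ → reverse σ ≡ map (at σ) js
  letters σ eq = trans (cong reverse (sym (map-at-idList σ)))
    (trans (sym (reverse-map (at σ) (idList (length σ)))) (cong (map (at σ) ∘ reverse ∘ idList) eq))
  letters′ = trans (letters ρ refl) (cong (map (at ρ)) (sym (unpaired-[] js)))
  paired = pairLoop-dist ρ π js js []
    (subst (AllPairs _>_) (sym (unpaired-[] js)) (idList-decreasing (length ρ)))
    (subst₂ (λ L P → Dist L P N) letters′ (letters π len) Δ)
  r     = proj₁ paired
  eq    = proj₁ (proj₂ paired)
  perm  = proj₁ (proj₂ (proj₂ paired))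
  total = proj₂ (proj₂ (proj₂ paired))
  total′ : inversions (reverse r) + sum ρ ≡ N + sum π
  total′ = trans (cong (_+_ (inversions (reverse r))) (trans (sym (sum-↭ (↭-reverse ρ))) (cong sum letters′)))
    (trans total (cong (_+_ N) (trans (cong sum (sym (letters π len))) (sum-↭ (↭-reverse π)))))
  cancel : ∀ I p r N → I + r ≡ N + p → + I - (+ p - + r) ≡ + N
  cancel I p r N eq = trans (r₁ (+ I) (+ p) (+ r)) (trans (cong (λ s → + s - + p) eq) (r₂ (+ N) (+ p)))
    where
    r₁ : ∀ i p r → i - (p - r) ≡ (i ℤ.+ r) - p
    r₁ = ℤ-solver.solve-∀
    r₂ : ∀ n p → (n ℤ.+ p) - p ≡ n
    r₂ = ℤ-solver.solve-∀

-- From storage order to written words, and assembly of the bounds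

reduced⇒word : ∀ n ρ → Reduced n w ρ → Word (idList n) (reverse ρ) w
reduced⇒word n ρ (_ , refl , len) = word-swaps ρ [] (trans (sym len)
  (sym (trans (cong (_+_ (length ρ)) (inversions-increasing (idList-increasing n))) (+-identityʳ _))))

theorem2p13 : (n : ℕ) (w : List ℕ) → w ↭ idList n →
    (ρ π : List ℕ) → Reduced n w ρ → Reduced n w π → SuperYamanouchi π →
    Σ (List ℕ) (λ v → permOf ρ π ≡ just v × v ↭ idList (length ρ) ×
    Σ ℕ (λ k → ((+ inversions v) - sumDiff π ρ ≡ + k) ×
    Σ (List (Move (length ρ))) (λ fs → length fs ≡ k × SuperYamanouchi (applyMoves fs ρ)) ×
    ((gs : List (Move (length ρ))) → SuperYamanouchi (applyMoves gs ρ) → k ≤ length gs)))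
theorem2p13 n w _ ρ π ρ-red@(_ , _ , len-ρ) π-red@(_ , _ , len-π) Y =
  let v , eq , perm , inv = permOf-dist ρ π (trans len-π (sym len-ρ)) Δ
  in v , eq , perm , N₀ , inv , sorting , λ gs → dist-≤-applyMoves inc S V gs ρ W Δ
  where
  inc = idList-increasing n
  W = reduced⇒word n ρ ρ-red
  V = reduced⇒word n π π-red
  S = superYamanouchi⇒sy V Y
  N₀ = proj₁ (dist-exists inc S V W)
  Δ = proj₂ (dist-exists inc S V W)
  sorting : Σ (List (Move (length ρ))) (λ fs → length fs ≡ N₀ × SuperYamanouchi (applyMoves fs ρ))
  sorting =
    -- The path ends at π itself, so its hypothesis `Y` transfers to the result.
    let fs , len , eq = applyMoves-complete (descend inc S V W Δ) (length-reverse ρ)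
    in fs , len , subst SuperYamanouchi
         (sym (trans (cong (applyMoves fs) (sym (reverse-involutive ρ))) (trans eq (reverse-involutive π)))) Y
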